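{- Algorithm-A (described in the context) decides CIS in time $O(\delta_0^n)$, where $n$ is the number of vertices of the input graph system and $\delta_0=1.4423\approx\sqrt[3]{3}$. That is, on every graph system $\mathcal{G}$ it returns true if and only if $\mathcal{G}$ has a good independent set, within the stated time.
   Context: A graph system is a tuple $\mathcal{G}=(G_0,G_1,\ldots,G_m)$ with $m\ge 1$, where all $G_i$ are graphs over the same finite vertex set $V$, $G_0$ is an undirected graph without self-loops, and $G_1,\ldots,G_m$ are directed graphs that may contain self-loops. Let $E_i$ be the edge set of $G_i$. For $\Gamma\subseteq V$ and $1\le i\le m$, a vertex $u\in\Gamma$ is $G_i$-good in $\Gamma$ if there is $v\in\Gamma$ (possibly $v=u$) with $(u,v)\in E_i$; it is good in $\Gamma$ if it is $G_i$-good in $\Gamma$ for every $1\le i\le m$, and bad in $\Gamma$ otherwise. A good independent set (GIS) is a non-empty set $\Gamma\subseteq V$ that is independent in $G_0$ and all of whose vertices are good in $\Gamma$. CIS is the problem: given $\mathcal{G}$, decide whether it has a GIS. Procedure 1, on input $\mathcal{G}$ and a set $Y\subseteq V$ independent in $G_0$: set $\Gamma:=Y$; while there is a bad vertex $u$ in $\Gamma$, set $\Gamma:=\Gamma\setminus\{u\}$; return true if $\Gamma\ne\emptyset$ and false otherwise. Algorithm-A, on input $\mathcal{G}$: enumerate all maximal (with respect to inclusion) independent sets $Y$ of $G_0$, using an algorithm that lists all of them in time $O(3^{n/3}\cdot\mathrm{poly}(n))$ (such algorithms are known); for each $Y$ run Procedure 1 on $(\mathcal{G},Y)$ and return true if it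 returns true; if no $Y$ succeeds, return false. Running times are measured in $n=|V|$; factors polynomial in the number $m$ of directed graphs are suppressed. -}

module Defs where

open import Data.Bool using (Bool; true; false; T; not; if_then_else_)
open import Data.Fin using (Fin)
open import Data.Fin.Subset using (Subset; _∈_; _⊆_; _-_; Nonempty)
open import Data.List using (List; []; _∷_; allFin)
import Data.List.Membership.Propositional as List
open import Data.Maybe using (Maybe; just; nothing)
open import Data.Nat using (ℕ; zero; suc; _+_; _*_; _^_; _≤_)
open import Data.Product using (∃; ∃₂; _×_)
open import Data.Vec using (lookup)
open import Function using (_⇔_)
open import Relation.Binary.Definitions using (Symmetric; Irreflexive)
open import Relation.Binary.PropositionalEquality using (_≡_)
open import Relation.Nullary using (¬_)

private
  variable
    n m : ℕ
    A B : Set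

------------------------------------------------------------------------
-- Graph systems over the vertex set Fin n; graphs are adjacency matrices

record Digraph (n : ℕ) : Set where
  field
    edge : Fin n → Fin n → Bool

  Edge : Fin n → Fin n → Set
  Edge u v = T (edge u v)

record Graph (n : ℕ) : Set where
  field
    edge : Fin n → Fin n → Bool

  Edge : Fin n → Fin n → Set
  Edge u v = T (edge u v)

  field
    symmetric   : Symmetric Edge
    irreflexive : Irreflexive _≡_ Edge

-- The directed graphs G₁, …, G_m are indexed by Fin m.
record GraphSystem (n m : ℕ) : Set where
  field
    1≤m : 1 ≤ m
    G₀  : Graph n
    G   : Fin m → Digraph n

Independent : Graph n → Subset n → Set
Independent H Γ = ∀ {u v} → u ∈ Γ → v ∈ Γ → ¬ Graph.Edge H u v

MaximalIndependent : Graph n → Subset n → Set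
MaximalIndependent H Y =
  Independent H Y × (∀ {Z} → Independent H Z → Y ⊆ Z → Z ⊆ Y)

GoodFor : Digraph n → Subset n → Fin n → Set
GoodFor D Γ u = ∃ λ v → v ∈ Γ × Digraph.Edge D u v

Good : GraphSystem n m → Subset n → Fin n → Set
Good 𝒢 Γ u = ∀ i → GoodFor (GraphSystem.G 𝒢 i) Γ u

GIS : GraphSystem n m → Subset n → Set
GIS 𝒢 Γ = Nonempty Γ
        × Independent (GraphSystem.G₀ 𝒢) Γ
        × (∀ {u} → u ∈ Γ → Good 𝒢 Γ u)

------------------------------------------------------------------------
-- Unit-cost computations
--
-- Sets and adjacency matrices are read one bit at a time.  Each bit read
-- and each loop iteration or exit costs 1; an operation that rewrites a
-- whole set costs n.

record Timed (A : Set) : Set where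
  constructor timed
  field
    value : A
    cost  : ℕ

open Timed public

return : A → Timed A
return x = timed x 0

infixl 1 _>>=_ _>>_

_>>=_ : Timed A → (A → Timed B) → Timed B
x >>= f = timed (value (f (value x))) (cost x + cost (f (value x)))

_>>_ : Timed A → Timed B → Timed B
x >> y = x >>= λ _ → y

charge : ℕ → A → Timed A
charge k x = timed x k

tick : Timed A → Timed A
tick x = timed (value x) (suc (cost x))

-- Linear search: the first element passing the test.
search : List A → (A → Timed Bool) → Timed (Maybe A)
search []       test = tick (return nothing)
search (x ∷ xs) test = tick do
  b ← test x
  if b then return (just x) else search xs test

isFound : Maybe A → Bool
isFound (just _) = true
isFound nothing  = false

exists : List A → (A → Timed Bool) → Timed Bool
exists xs test = do
  r ← search xs test
  return (isFound r)

------------------------------------------------------------------------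
-- Procedure 1

member : Subset n → Fin n → Timed Bool
member Γ u = charge 1 (lookup Γ u)

lacksSuccessor : Digraph n → Subset n → Fin n → Timed Bool
lacksSuccessor {n} D Γ u = do
  b ← exists (allFin n) λ v → do
        v∈Γ ← member Γ v
        if v∈Γ then charge 1 (Digraph.edge D u v) else return false
  return (not b)

isBad : GraphSystem n m → Subset n → Fin n → Timed Bool
isBad {m = m} 𝒢 Γ u = do
  u∈Γ ← member Γ u
  if u∈Γ
    then exists (allFin m) (λ i → lacksSuccessor (GraphSystem.G 𝒢 i) Γ u)
    else return false

-- The while loop.  The first argument only serves termination: every
-- round removes an element of Γ, so a budget of n rounds always suffices
-- (after n removals Γ is empty and has no bad vertex).
removeBad : ℕ → GraphSystem n m → Subset n → Timed (Subset n)
removeBad zero    𝒢 Γ = return Γ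
removeBad {n} (suc k) 𝒢 Γ = tick do
  just u ← search (allFin n) (isBad 𝒢 Γ)
    where nothing → return Γ
  Γ′ ← charge n (Γ - u)
  removeBad k 𝒢 Γ′

procedure1 : GraphSystem n m → Subset n → Timed Bool
procedure1 {n} 𝒢 Y = do
  Γ  ← charge n Y
  Γ′ ← removeBad n 𝒢 Γ
  exists (allFin n) (member Γ′)

------------------------------------------------------------------------
-- Enumeration algorithms
--
-- The run of an enumeration algorithm is the finite sequence of its unit
-- steps, some of which output a set.  In particular outputting a set takes
-- time at least 1, so the number of outputs is at most the running time.

data Run (n : ℕ) : Set where
  halt : Run n
  step : Run n → Run n
  emit : Subset n → Run n → Run n

steps : Run n → ℕ
steps halt       = 0
steps (step r)   = suc (steps r)
steps (emit _ r) = suc (steps r)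

outputs : Run n → List (Subset n)
outputs halt       = []
outputs (step r)   = outputs r
outputs (emit Y r) = Y ∷ outputs r

Enumerator : Set
Enumerator = ∀ {n} → Graph n → Run n

ListsMaximalIndependentSets : Enumerator → Set
ListsMaximalIndependentSets enum =
  ∀ {n} (H : Graph n) (Y : Subset n) →
  Y List.∈ outputs (enum H) ⇔ MaximalIndependent H Y

-- steps ≤ c (n+1)^d · 3^(n/3), with both sides cubed since 3^(n/3) is
-- irrational in general.
TimeO[3^n/3·poly] : Enumerator → Set
TimeO[3^n/3·poly] enum =
  ∃₂ λ c d → ∀ {n} (H : Graph n) →
  steps (enum H) ^ 3 ≤ (c * suc n ^ d) ^ 3 * 3 ^ n

------------------------------------------------------------------------
-- Algorithm-A

-- The enumeration is interleaved with Procedure 1 and abandoned at the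
-- first success.
tryAll : GraphSystem n m → Run n → Timed Bool
tryAll 𝒢 halt       = tick (return false)
tryAll 𝒢 (step r)   = tick (tryAll 𝒢 r)
tryAll 𝒢 (emit Y r) = tick do
  b ← procedure1 𝒢 Y
  if b then return true else tryAll 𝒢 r

Algorithm : Set
Algorithm = ∀ {n m} → GraphSystem n m → Timed Bool

algorithmA : Enumerator → Algorithm
algorithmA enum 𝒢 = tryAll 𝒢 (enum (GraphSystem.G₀ 𝒢))

DecidesCIS : Algorithm → Set
DecidesCIS alg =
  ∀ {n m} (𝒢 : GraphSystem n m) → value (alg 𝒢) ≡ true ⇔ ∃ (GIS 𝒢)

-- Time O((p/q)^n) up to a factor polynomial in m:
-- cost ≤ C · m^k · (p/q)^n, with denominators cleared.  As m ≥ 1, the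
-- factors C · m^k dominate all polynomials in m.
TimeO[_/_^n] : ℕ → ℕ → Algorithm → Set
TimeO[ p / q ^n] alg =
  ∃₂ λ C k → ∀ {n m} (𝒢 : GraphSystem n m) →
  cost (alg 𝒢) * q ^ n ≤ C * m ^ k * p ^ n

{-# OPTIONS --safe #-}
-- Correctness: goodness is monotone in Γ, so Procedure 1 never deletes a vertex
-- of a good subset of Y and stops at the largest such subset; and every
-- independent set extends to a maximal one.
--
-- Running time: Procedure 1 costs O(m (n+1)³), and 3 · 10000³ < 14423³, so the
-- polynomial factor is absorbed by the gap between the bases.  The comparison is
-- made between cubes, as the enumeration bound is.
module Submission where

open import Defs
import Algebra.Properties.CommutativeSemigroup as CommutativeSemigroupProperties
open import Data.Bool using (Bool; true; false; if_then_else_)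
open import Data.Bool.Properties using (T-≡)
open import Data.Fin using (Fin)
import Data.Fin.Properties as Fin
open import Data.Fin.Subset using (Subset; _∈_; _⊆_; _⊃_; _-_; Nonempty; ∣_∣)
open import Data.Fin.Subset.Induction using (⊃-wellFounded)
open import Data.Fin.Subset.Properties
open import Data.List using (List; []; _∷_; allFin; length)
open import Data.List.Membership.Propositional using (lose; find)
open import Data.List.Membership.Propositional.Properties using (∈-allFin)
open import Data.List.Properties using (length-tabulate)
open import Data.List.Relation.Unary.All as All using (All; []; _∷_)
open import Data.List.Relation.Unary.Any using (Any; here; there)
open import Data.Maybe using (Maybe; just; nothing)
open import Data.Nat
  using (ℕ; zero; suc; _+_; _*_; _^_; _≤_; _<_; s≤s; z≤n; NonZero; >-nonZero)
open import Data.Nat.Properties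
open import Data.Nat.Tactic.RingSolver using (solve-∀)
open import Data.Product using (∃; _×_; _,_; proj₁; proj₂)
open import Data.Sum using (inj₁; inj₂)
open import Data.Vec.Properties using ([]=⇒lookup; lookup⇒[]=)
open import Function using (mk⇔; Equivalence; _∘_; id)
open import Induction.WellFounded using (Acc; acc)
open import Relation.Binary.PropositionalEquality
  using (_≡_; refl; sym; trans; cong; cong₂; subst)
open import Relation.Nullary using (¬_; Dec; yes; no; contradiction)
open import Relation.Nullary.Decidable
  using (map′; _×-dec_; _→-dec_; ¬?; T?; decidable-stable; from-yes)
open import Relation.Nullary.Reflects
  using (Reflects; ofʸ; ofⁿ; T-reflects; ¬-reflects; fromEquivalence)

open CommutativeSemigroupProperties *-commutativeSemigroup using (interchange; x∙yz≈y∙xz)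

private
  variable
    n m : ℕ
    A B : Set
    P : A → Set

-- Values of timed computations

-- Indexed by the result of the search, so that matching on it alongside the value yields either the
-- witness or the refutation for every element.
data SearchSpec (P : A → Set) (xs : List A) : Maybe A → Set where
  found  : ∀ {x} → P x → SearchSpec P xs (just x)
  absent : All (¬_ ∘ P) xs → SearchSpec P xs nothing

search-spec : ∀ (xs : List A) (test : A → Timed Bool) →
              (∀ x → Reflects (P x) (value (test x))) →
              SearchSpec P xs (value (search xs test))
search-spec []       test r = absent []
search-spec (x ∷ xs) test r with value (test x) | r x
... | true  | ofʸ px = found px
... | false | ofⁿ ¬px with value (search xs test) | search-spec xs test r
...   | just _  | found py    = found py
...   | nothing | absent none = absent (¬px ∷ none)

exists-reflects : ∀ {P : Fin n → Set} {test} →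
                  (∀ x → Reflects (P x) (value (test x))) →
                  Reflects (∃ P) (value (exists (allFin n) test))
exists-reflects {n} {test = test} r
  with value (search (allFin n) test) | search-spec (allFin n) test r
... | just x  | found px    = ofʸ (x , px)
... | nothing | absent none = ofⁿ λ (x , px) → All.lookup none (∈-allFin x) px

and-reflects : ∀ (x : Timed Bool) {y : Timed Bool} →
               Reflects A (value x) → Reflects B (value y) →
               Reflects (A × B)
                 (value (x >>= λ b → if b then y else return false))
and-reflects (timed true  _) (ofʸ a)  (ofʸ b)  = ofʸ (a , b)
and-reflects (timed true  _) (ofʸ a)  (ofⁿ ¬b) = ofⁿ (¬b ∘ proj₂)
and-reflects (timed false _) (ofⁿ ¬a) _        = ofⁿ (¬a ∘ proj₁)

member-reflects : (Γ : Subset n) (u : Fin n) → Reflects (u ∈ Γ) (value (member Γ u))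
member-reflects Γ u = fromEquivalence
  (lookup⇒[]= u Γ ∘ Equivalence.to T-≡) (Equivalence.from T-≡ ∘ []=⇒lookup)

lacksSuccessor-reflects : (D : Digraph n) (Γ : Subset n) (u : Fin n) →
                          Reflects (¬ GoodFor D Γ u) (value (lacksSuccessor D Γ u))
lacksSuccessor-reflects D Γ u = ¬-reflects (exists-reflects λ v →
  and-reflects (member Γ v) (member-reflects Γ v) (T-reflects (Digraph.edge D u v)))

-- Badness carries the index of a failing digraph, as `isBad` searches for it; decidability of
-- `GoodFor` makes this equivalent to failing `Good`.
Bad : GraphSystem n m → Subset n → Fin n → Set
Bad 𝒢 Γ u = u ∈ Γ × ∃ λ i → ¬ GoodFor (GraphSystem.G 𝒢 i) Γ u

isBad-reflects : (𝒢 : GraphSystem n m) (Γ : Subset n) (u : Fin n) →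
                 Reflects (Bad 𝒢 Γ u) (value (isBad 𝒢 Γ u))
isBad-reflects 𝒢 Γ u = and-reflects (member Γ u) (member-reflects Γ u)
  (exists-reflects λ i → lacksSuccessor-reflects (GraphSystem.G 𝒢 i) Γ u)

-- Procedure 1

AllGood : GraphSystem n m → Subset n → Set
AllGood 𝒢 Γ = ∀ {u} → u ∈ Γ → Good 𝒢 Γ u

goodFor? : (D : Digraph n) (Γ : Subset n) (u : Fin n) → Dec (GoodFor D Γ u)
goodFor? D Γ u = Fin.any? λ v → v ∈? Γ ×-dec T? (Digraph.edge D u v)

goodFor-mono : ∀ {D : Digraph n} {Δ Γ u} → Δ ⊆ Γ → GoodFor D Δ u → GoodFor D Γ u
goodFor-mono Δ⊆Γ (v , v∈Δ , e) = v , Δ⊆Γ v∈Δ , e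

¬bad⇒allGood : (𝒢 : GraphSystem n m) {Γ : Subset n} → (∀ u → ¬ Bad 𝒢 Γ u) → AllGood 𝒢 Γ
¬bad⇒allGood 𝒢 {Γ} ¬bad {u} u∈Γ i =
  decidable-stable (goodFor? (GraphSystem.G 𝒢 i) Γ u) λ ¬good → ¬bad u (u∈Γ , i , ¬good)

-- A successor inside Δ is also a successor inside Γ, so a vertex bad in Γ cannot lie in a good
-- subset. This is what makes the order of deletions irrelevant.
bad∉allGood : (𝒢 : GraphSystem n m) {Δ Γ : Subset n} {u : Fin n} →
              AllGood 𝒢 Δ → Δ ⊆ Γ → Bad 𝒢 Γ u → ¬ u ∈ Δ
bad∉allGood 𝒢 good Δ⊆Γ (_ , i , ¬good) u∈Δ =
  ¬good (goodFor-mono {D = GraphSystem.G 𝒢 i} Δ⊆Γ (good u∈Δ i))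

∣p∣≤0⇒∉ : ∀ {p : Subset n} {x} → ∣ p ∣ ≤ 0 → ¬ x ∈ p
∣p∣≤0⇒∉ ∣p∣≤0 x∈p = n≮0 (<-≤-trans (x∈p⇒∣p-x∣<∣p∣ x∈p) ∣p∣≤0)

removeBad-⊆ : ∀ k (𝒢 : GraphSystem n m) Γ → value (removeBad k 𝒢 Γ) ⊆ Γ
removeBad-⊆ zero 𝒢 Γ x∈ = x∈
removeBad-⊆ {n} (suc k) 𝒢 Γ x∈ with value (search (allFin n) (isBad 𝒢 Γ))
... | just u  = p─q⊆p Γ _ (removeBad-⊆ k 𝒢 (Γ - u) x∈)
... | nothing = x∈

-- Each deleted vertex belongs to the current set, so its size drops along with the budget; an
-- exhausted budget means an empty set, which is vacuously good.
removeBad-allGood : ∀ k (𝒢 : GraphSystem n m) Γ → ∣ Γ ∣ ≤ k →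
                    AllGood 𝒢 (value (removeBad k 𝒢 Γ))
removeBad-allGood zero 𝒢 Γ ∣Γ∣≤0 u∈Γ = contradiction u∈Γ (∣p∣≤0⇒∉ ∣Γ∣≤0)
removeBad-allGood {n} (suc k) 𝒢 Γ ∣Γ∣≤1+k
  with value (search (allFin n) (isBad 𝒢 Γ))
     | search-spec (allFin n) (isBad 𝒢 Γ) (isBad-reflects 𝒢 Γ)
... | just u  | found (u∈Γ , _) =
  removeBad-allGood k 𝒢 (Γ - u) (≤-pred (<-≤-trans (x∈p⇒∣p-x∣<∣p∣ u∈Γ) ∣Γ∣≤1+k))
... | nothing | absent none = ¬bad⇒allGood 𝒢 λ u → All.lookup none (∈-allFin u)

-- Loop invariant: the deleted vertex is bad in the current set, hence not in Δ.
removeBad-⊇ : ∀ k (𝒢 : GraphSystem n m) {Δ} Γ → AllGood 𝒢 Δ → Δ ⊆ Γ →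
              Δ ⊆ value (removeBad k 𝒢 Γ)
removeBad-⊇ zero 𝒢 Γ good Δ⊆Γ = Δ⊆Γ
removeBad-⊇ {n} (suc k) 𝒢 {Δ} Γ good Δ⊆Γ
  with value (search (allFin n) (isBad 𝒢 Γ))
     | search-spec (allFin n) (isBad 𝒢 Γ) (isBad-reflects 𝒢 Γ)
... | nothing | _         = Δ⊆Γ
... | just u  | found bad = removeBad-⊇ k 𝒢 (Γ - u) good λ x∈Δ →
  x∈p∧x≢y⇒x∈p-y (Δ⊆Γ x∈Δ) λ x≡u →
    bad∉allGood 𝒢 good Δ⊆Γ bad (subst (_∈ Δ) x≡u x∈Δ)

procedure1-reflects : (𝒢 : GraphSystem n m) (Y : Subset n) →
                      Reflects (∃ λ Γ → Nonempty Γ × Γ ⊆ Y × AllGood 𝒢 Γ)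
                               (value (procedure1 𝒢 Y))
procedure1-reflects {n} 𝒢 Y
  with value (procedure1 𝒢 Y)
     | exists-reflects {test = member (value (removeBad n 𝒢 Y))}
         (member-reflects (value (removeBad n 𝒢 Y)))
-- The witness is the final set of the loop; the budget n is enough because Y has at most n
-- elements.
... | true  | ofʸ nonempty =
  ofʸ (_ , nonempty , removeBad-⊆ n 𝒢 Y , removeBad-allGood n 𝒢 Y (∣p∣≤n Y))
... | false | ofⁿ empty =
  ofⁿ λ (Γ , (x , x∈Γ) , Γ⊆Y , good) → empty (x , removeBad-⊇ n 𝒢 Y good Γ⊆Y x∈Γ)

-- Maximal independent sets

independent? : (H : Graph n) (Γ : Subset n) → Dec (Independent H Γ)
independent? H Γ = map′ (λ ind {u} {v} → ind u v) (λ ind u v → ind)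
  (Fin.all? λ u → Fin.all? λ v →
    u ∈? Γ →-dec (v ∈? Γ →-dec ¬? (T? (Graph.edge H u v))))

independent-⊆ : ∀ {H : Graph n} {Γ Y} → Γ ⊆ Y → Independent H Y → Independent H Γ
independent-⊆ Γ⊆Y ind u∈Γ v∈Γ = ind (Γ⊆Y u∈Γ) (Γ⊆Y v∈Γ)

¬⊃⇒maximal : ∀ {H : Graph n} {Γ} → Independent H Γ →
             ¬ (∃ λ Z → Independent H Z × Z ⊃ Γ) → MaximalIndependent H Γ
¬⊃⇒maximal {Γ = Γ} ind ¬larger = ind , λ {Z} indZ Γ⊆Z {x} x∈Z →
  decidable-stable (x ∈? Γ) λ x∉Γ → ¬larger (Z , indZ , Γ⊆Z , x , x∈Z , x∉Γ)

-- Pass to a strictly larger independent set as long as one exists; strict growth of subsets of a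
-- finite set is well-founded, and existence is decided by searching all subsets.
extendToMaximal : (H : Graph n) {Γ : Subset n} → Independent H Γ →
                  ∃ λ Y → MaximalIndependent H Y × Γ ⊆ Y
extendToMaximal H ind = go ind (⊃-wellFounded _)
  where
  go : ∀ {Γ} → Independent H Γ → Acc _⊃_ Γ → ∃ λ Y → MaximalIndependent H Y × Γ ⊆ Y
  go {Γ} ind (acc rec) with anySubset? (λ Z → independent? H Z ×-dec Γ ⊂? Z)
  ... | no ¬larger = Γ , ¬⊃⇒maximal {H = H} ind ¬larger , id
  ... | yes (Z , indZ , Γ⊂Z) =
    let Y , max , Z⊆Y = go indZ (rec Γ⊂Z) in Y , max , Z⊆Y ∘ p⊂q⇒p⊆q Γ⊂Z

-- Correctness

tryAll-sound : (𝒢 : GraphSystem n m) (r : Run n) → value (tryAll 𝒢 r) ≡ true →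
               Any (λ Y → ∃ λ Γ → Nonempty Γ × Γ ⊆ Y × AllGood 𝒢 Γ) (outputs r)
tryAll-sound 𝒢 (step r)   eq = tryAll-sound 𝒢 r eq
tryAll-sound 𝒢 (emit Y r) eq with value (procedure1 𝒢 Y) | procedure1-reflects 𝒢 Y
... | true  | ofʸ Γ = here Γ
... | false | _     = there (tryAll-sound 𝒢 r eq)

tryAll-complete : (𝒢 : GraphSystem n m) (r : Run n) →
                  Any (λ Y → ∃ λ Γ → Nonempty Γ × Γ ⊆ Y × AllGood 𝒢 Γ) (outputs r) →
                  value (tryAll 𝒢 r) ≡ true
tryAll-complete 𝒢 (step r)   any = tryAll-complete 𝒢 r any
tryAll-complete 𝒢 (emit Y r) any
  with value (procedure1 𝒢 Y) | procedure1-reflects 𝒢 Y | any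
... | true  | _      | _         = refl
... | false | ofⁿ ¬Γ | here Γ    = contradiction Γ ¬Γ
... | false | _      | there any = tryAll-complete 𝒢 r any

algorithmA-decides : (enum : Enumerator) → ListsMaximalIndependentSets enum →
                     DecidesCIS (algorithmA enum)
algorithmA-decides enum lists 𝒢 = mk⇔ sound complete
  where
  open GraphSystem 𝒢 using (G₀)

  sound : value (algorithmA enum 𝒢) ≡ true → ∃ (GIS 𝒢)
  sound eq =
    let Y , Y∈ , Γ , nonempty , Γ⊆Y , good = find (tryAll-sound 𝒢 (enum G₀) eq)
        indY , _ = Equivalence.to (lists G₀ Y) Y∈
    in Γ , nonempty , independent-⊆ {H = G₀} Γ⊆Y indY , good

  complete : ∃ (GIS 𝒢) → value (algorithmA enum 𝒢) ≡ true
  complete (Γ , nonempty , ind , good) =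
    -- The GIS itself may not be listed, but a maximal extension of it is, and Procedure 1 succeeds
    -- on any listed set containing a GIS.
    let Y , max , Γ⊆Y = extendToMaximal G₀ ind
    in tryAll-complete 𝒢 (enum G₀)
         (lose (Equivalence.from (lists G₀ Y) max) (Γ , nonempty , Γ⊆Y , good))

-- Cost

-- Each iteration pays one tick on top of its test; the outer `suc` is the tick for leaving an
-- exhausted list.
search-cost : ∀ (xs : List A) {test k} → (∀ x → cost (test x) ≤ k) →
              cost (search xs test) ≤ suc (length xs * suc k)
search-cost []       bound = ≤-refl
search-cost (x ∷ xs) {test} {k} bound = s≤s (begin
  cost (test x) + cost (if value (test x) then return (just x) else search xs test)
    ≤⟨ +-mono-≤ (bound x) (rest (value (test x))) ⟩
  k + suc (length xs * suc k)
    ≡⟨ +-suc k _ ⟩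
  suc k + length xs * suc k ∎)
  where
  open ≤-Reasoning
  rest : ∀ b → cost (if b then return (just x) else search xs test)
               ≤ suc (length xs * suc k)
  rest true  = z≤n
  rest false = search-cost xs bound

searchFin-cost : ∀ {test : Fin n → Timed Bool} {k} → (∀ x → cost (test x) ≤ k) →
                 cost (search (allFin n) test) ≤ suc (n * suc k)
searchFin-cost {n} {test} {k} bound =
  subst (λ l → cost (search (allFin n) test) ≤ suc (l * suc k))
        (length-tabulate (id {A = Fin n})) (search-cost (allFin n) bound)

existsFin-cost : ∀ {test : Fin n → Timed Bool} {k} → (∀ x → cost (test x) ≤ k) →
                 cost (exists (allFin n) test) ≤ suc (n * suc k)
existsFin-cost {n} {test} bound =
  ≤-trans (≤-reflexive (+-identityʳ (cost (search (allFin n) test)))) (searchFin-cost bound)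

and-cost : ∀ (x : Timed Bool) {y : Timed Bool} {k l} → cost x ≤ k → cost y ≤ l →
           cost (x >>= λ b → if b then y else return false) ≤ k + l
and-cost (timed true  _) x≤k y≤l = +-mono-≤ x≤k y≤l
and-cost (timed false _) x≤k y≤l = +-mono-≤ x≤k z≤n

-- The 3 counts two bit reads, membership and edge, and one loop iteration.
lacksSuccessor-cost : (D : Digraph n) (Γ : Subset n) (u : Fin n) →
                      cost (lacksSuccessor D Γ u) ≤ suc (n * 3)
lacksSuccessor-cost D Γ u = ≤-trans (≤-reflexive (+-identityʳ _))
  (existsFin-cost λ v → and-cost (member Γ v) ≤-refl ≤-refl)

-- The summands follow the code: a round is its tick, the search for a bad vertex and a deletion of
-- cost n; Procedure 1 is a copy of cost n, at most n rounds and the final scan for an element.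
isBadBound roundBound procedure1Bound : ℕ → ℕ → ℕ
isBadBound      n m = 2 + m * (2 + n * 3)
roundBound      n m = suc (suc (n * suc (isBadBound n m)) + n)
procedure1Bound n m = n + (n * roundBound n m + suc (n * 2))

isBad-cost : (𝒢 : GraphSystem n m) (Γ : Subset n) (u : Fin n) →
             cost (isBad 𝒢 Γ u) ≤ isBadBound n m
isBad-cost 𝒢 Γ u = and-cost (member Γ u) ≤-refl
  (existsFin-cost λ i → lacksSuccessor-cost (GraphSystem.G 𝒢 i) Γ u)

badSearch-cost : (𝒢 : GraphSystem n m) (Γ : Subset n) →
                 cost (search (allFin n) (isBad 𝒢 Γ)) ≤ suc (n * suc (isBadBound n m))
badSearch-cost 𝒢 Γ = searchFin-cost {test = isBad 𝒢 Γ} (isBad-cost 𝒢 Γ)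

removeBad-cost : ∀ k (𝒢 : GraphSystem n m) Γ →
                 cost (removeBad k 𝒢 Γ) ≤ k * roundBound n m
removeBad-cost zero 𝒢 Γ = z≤n
removeBad-cost {n} {m} (suc k) 𝒢 Γ
  with value (search (allFin n) (isBad 𝒢 Γ))
... | nothing = ≤-trans (s≤s (+-mono-≤ (badSearch-cost 𝒢 Γ) z≤n)) (m≤m+n _ _)
... | just u  = ≤-trans
  -- Reassociating separates the cost of this round from that of the remaining ones.
  (≤-reflexive (cong suc (sym (+-assoc (cost (search (allFin n) (isBad 𝒢 Γ))) n _))))
  (+-mono-≤ (s≤s (+-monoˡ-≤ n (badSearch-cost 𝒢 Γ))) (removeBad-cost k 𝒢 (Γ - u)))

procedure1-cost : (𝒢 : GraphSystem n m) (Y : Subset n) →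
                  cost (procedure1 𝒢 Y) ≤ procedure1Bound n m
procedure1-cost {n} 𝒢 Y = +-monoʳ-≤ n (+-mono-≤ (removeBad-cost n 𝒢 Y)
  (existsFin-cost {test = member (value (removeBad n 𝒢 Y))} λ v → ≤-refl))

-- Every step of the run is charged its tick plus a whole run of Procedure 1; the extra `suc` on the
-- steps pays for `halt`.
tryAll-cost : (𝒢 : GraphSystem n m) (r : Run n) →
              cost (tryAll 𝒢 r) ≤ suc (steps r) * suc (procedure1Bound n m)
tryAll-cost 𝒢 halt = s≤s z≤n
tryAll-cost 𝒢 (step r) = +-mono-≤ (s≤s z≤n) (tryAll-cost 𝒢 r)
tryAll-cost {n} {m} 𝒢 (emit Y r) =
  +-mono-≤ (s≤s (procedure1-cost 𝒢 Y)) (rest (value (procedure1 𝒢 Y)))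
  where
  rest : ∀ b → cost (if b then return true else tryAll 𝒢 r)
               ≤ suc (steps r) * suc (procedure1Bound n m)
  rest true  = z≤n
  rest false = tryAll-cost 𝒢 r

procedure1Bound-≤ : ∀ n m → 1 ≤ m → suc (procedure1Bound n m) ≤ 3 * m * suc n ^ 3
procedure1Bound-≤ n (suc j) _ = begin
  suc (procedure1Bound n (suc j))                 ≤⟨ m≤m+n _ _ ⟩
  suc (procedure1Bound n (suc j)) +
    -- The difference of the two sides; with m = 1 + j it has only non-negative coefficients.
    ((3 * n * n + 4 * n + 1) + j * (7 * n * n + 9 * n + 3))
                                                  ≡⟨ eq n j ⟩
  3 * suc j * suc n ^ 3                           ∎
  where
  open ≤-Reasoning
  eq : ∀ n j →
    suc (n + (n * suc (suc (n * suc (2 + suc j * (2 + n * 3))) + n) + suc (n * 2))) +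
      ((3 * n * n + 4 * n + 1) + j * (7 * n * n + 9 * n + 3))
    ≡ 3 * suc j * (suc n * (suc n * (suc n * 1)))
  eq = solve-∀

-- Exponentials absorb polynomials

^-distribʳ-* : ∀ k x y → (x * y) ^ k ≡ x ^ k * y ^ k
^-distribʳ-* zero    x y = refl
^-distribʳ-* (suc k) x y = trans (cong (x * y *_) (^-distribʳ-* k x y))
  (interchange x y (x ^ k) (y ^ k))

^-swap : ∀ x k l → (x ^ k) ^ l ≡ (x ^ l) ^ k
^-swap x k l = trans (^-*-assoc x k l)
  (trans (cong (x ^_) (*-comm k l)) (sym (^-*-assoc x l k)))

^-cancelʳ-≤ : ∀ k .{{_ : NonZero k}} {x y} → x ^ k ≤ y ^ k → x ≤ y
^-cancelʳ-≤ k x^k≤y^k = ≮⇒≥ λ y<x → <⇒≱ (^-monoˡ-< k y<x) x^k≤y^k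

-- (1 + 1/x)^e ≤ 1 + K/x with denominators cleared.
bernoulli-upper : ∀ e → ∃ λ K → ∀ x → 1 ≤ x → x * suc x ^ e ≤ x ^ e * (x + K)
bernoulli-upper zero    = 0 , λ x _ → ≤-reflexive (lemma x)
  where
  lemma : ∀ x → x * 1 ≡ 1 * (x + 0)
  lemma = solve-∀
bernoulli-upper (suc e) with bernoulli-upper e
-- The product (x + 1)(x + K) is x² + x + Kx + K, and K ≤ Kx since x ≥ 1, which gives x(x + 1 + 2K).
... | K , bound = 1 + 2 * K , λ x 1≤x → begin
  x * (suc x * suc x ^ e)             ≡⟨ x∙yz≈y∙xz x (suc x) (suc x ^ e) ⟩
  suc x * (x * suc x ^ e)             ≤⟨ *-monoʳ-≤ (suc x) (bound x 1≤x) ⟩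
  suc x * (x ^ e * (x + K))           ≡⟨ expand x (x ^ e) K ⟩
  x ^ e * (x * x + x + K * x + K * 1)
    ≤⟨ *-monoʳ-≤ (x ^ e) (+-monoʳ-≤ (x * x + x + K * x) (*-monoʳ-≤ K 1≤x)) ⟩
  x ^ e * (x * x + x + K * x + K * x) ≡⟨ collect x (x ^ e) K ⟩
  x * x ^ e * (x + (1 + 2 * K))       ∎
  where
  open ≤-Reasoning
  expand : ∀ x p K → suc x * (p * (x + K)) ≡ p * (x * x + x + K * x + K * 1)
  expand = solve-∀
  collect : ∀ x p K → p * (x * x + x + K * x + K * x) ≡ x * p * (x + (1 + 2 * K))
  collect = solve-∀

-- By the previous bound, a(1 + 1/x)^e ≤ a + aK/x, which is at most a + 1 ≤ b once x ≥ aK.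
ratio-eventually-≤ : ∀ e {a b} → a < b →
                     ∃ λ N → ∀ x → 1 ≤ x → N ≤ x → a * suc x ^ e ≤ b * x ^ e
ratio-eventually-≤ e {a} {b} a<b with bernoulli-upper e
... | K , bound = a * K , λ x 1≤x aK≤x →
  *-cancelˡ-≤ x {{>-nonZero 1≤x}} (begin
    x * (a * suc x ^ e)     ≡⟨ x∙yz≈y∙xz x a (suc x ^ e) ⟩
    a * (x * suc x ^ e)     ≤⟨ *-monoʳ-≤ a (bound x 1≤x) ⟩
    a * (x ^ e * (x + K))   ≡⟨ expand x a (x ^ e) K ⟩
    x ^ e * (a * x + a * K) ≤⟨ *-monoʳ-≤ (x ^ e) (+-monoʳ-≤ (a * x) aK≤x) ⟩
    x ^ e * (a * x + x)     ≡⟨ collect x a (x ^ e) ⟩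
    suc a * (x * x ^ e)     ≤⟨ *-monoˡ-≤ (x * x ^ e) a<b ⟩
    b * (x * x ^ e)         ≡⟨ x∙yz≈y∙xz b x (x ^ e) ⟩
    x * (b * x ^ e)         ∎)
  where
  open ≤-Reasoning
  expand : ∀ x a p K → a * (p * (x + K)) ≡ p * (a * x + a * K)
  expand = solve-∀
  collect : ∀ x a p → p * (a * x + x) ≡ suc a * (x * p)
  collect = solve-∀

-- Up to the threshold N the constant alone dominates the polynomial; beyond it each step multiplies
-- the left side by at most b.
poly*exp≤exp : ∀ e {a b} → a < b → ∃ λ B → ∀ n → suc n ^ e * a ^ n ≤ B * b ^ n
poly*exp≤exp e {a} {b} a<b with ratio-eventually-≤ e a<b
... | N , ratio = suc N ^ e , go
  where
  open ≤-Reasoning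
  regroup : ∀ p a q → p * (a * q) ≡ a * p * q
  regroup = solve-∀
  go : ∀ n → suc n ^ e * a ^ n ≤ suc N ^ e * b ^ n
  go zero = *-monoˡ-≤ 1 (^-monoˡ-≤ e (s≤s (z≤n {N})))
  go (suc n) with ≤-total N (suc n)
  ... | inj₂ 1+n≤N = *-mono-≤ (^-monoˡ-≤ e (s≤s 1+n≤N)) (^-monoˡ-≤ (suc n) (<⇒≤ a<b))
  ... | inj₁ N≤1+n = begin
    suc (suc n) ^ e * (a * a ^ n) ≡⟨ regroup (suc (suc n) ^ e) a (a ^ n) ⟩
    a * suc (suc n) ^ e * a ^ n   ≤⟨ *-monoˡ-≤ (a ^ n) (ratio (suc n) (s≤s z≤n) N≤1+n) ⟩
    b * suc n ^ e * a ^ n         ≡⟨ *-assoc b _ _ ⟩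
    b * (suc n ^ e * a ^ n)       ≤⟨ *-monoʳ-≤ b (go n) ⟩
    b * (suc N ^ e * b ^ n)       ≡⟨ x∙yz≈y∙xz b (suc N ^ e) (b ^ n) ⟩
    suc N ^ e * (b * b ^ n)       ∎

-- Running time of Algorithm-A

-- For s ≥ 1 this is s + 1 ≤ 2s cubed; the added 1 covers s = 0. It passes from the cubed number of
-- steps to the cube of its successor, as `tryAll-cost` requires.
suc-cube-≤ : ∀ s → suc s ^ 3 ≤ 8 * (s ^ 3 + 1)
suc-cube-≤ zero    = from-yes (1 ≤? 8)
suc-cube-≤ (suc s) = ≤-trans (m≤m+n _ _) (≤-reflexive (eq s))
  where
  eq : ∀ s → suc (suc s) * (suc (suc s) * (suc (suc s) * 1)) +
             (7 * s * s * s + 18 * s * s + 12 * s + 8)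
           ≡ 8 * (suc s * (suc s * (suc s * 1)) + 1)
  eq = solve-∀

-- The added 1 is absorbed because `Q` is at least 1; c may be 0, hence the factor c³ + 1.
suc-steps-≤ : ∀ {c d s n} → s ^ 3 ≤ (c * suc n ^ d) ^ 3 * 3 ^ n →
              suc s ^ 3 ≤ 8 * (c ^ 3 + 1) * ((suc n ^ d) ^ 3 * 3 ^ n)
suc-steps-≤ {c} {d} {s} {n} s≤ = begin
  suc s ^ 3
    ≤⟨ suc-cube-≤ s ⟩
  8 * (s ^ 3 + 1)
    ≤⟨ *-monoʳ-≤ 8 (+-mono-≤ s≤ 1≤Q) ⟩
  8 * ((c * suc n ^ d) ^ 3 * 3 ^ n + Q)
    ≡⟨ cong (λ z → 8 * (z * 3 ^ n + Q)) (^-distribʳ-* 3 c (suc n ^ d)) ⟩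
  8 * (c ^ 3 * (suc n ^ d) ^ 3 * 3 ^ n + Q)
    ≡⟨ collect (c ^ 3) ((suc n ^ d) ^ 3) (3 ^ n) ⟩
  8 * (c ^ 3 + 1) * Q ∎
  where
  open ≤-Reasoning
  Q = (suc n ^ d) ^ 3 * 3 ^ n
  1≤Q : 1 ≤ Q
  1≤Q = *-mono-≤ (m^n>0 (suc n ^ d) {{m^n≢0 (suc n) d}} 3) (m^n>0 3 n)
  collect : ∀ c p t → 8 * (c * p * t + p * t) ≡ 8 * (c + 1) * (p * t)
  collect = solve-∀

algorithmA-time : ∀ p q → 3 * q ^ 3 < p ^ 3 →
                  (enum : Enumerator) → TimeO[3^n/3·poly] enum →
                  TimeO[ p / q ^n] (algorithmA enum)
algorithmA-time p q 3q³<p³ enum (c , d , fast) = C , 1 , time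
  where
  open ≤-Reasoning
  A₀ = 8 * (c ^ 3 + 1)
  -- The exponent collects the cubes of (n+1)^d from the enumeration and of (n+1)³ from Procedure 1.
  absorb = poly*exp≤exp (d * 3 + 3 * 3) 3q³<p³
  B₀ = proj₁ absorb
  -- 27 is the cube of the factor 3 in `procedure1Bound-≤`.
  C = 27 * A₀ * B₀

  absorb-cubes : ∀ n → (suc n ^ d) ^ 3 * 3 ^ n * ((suc n ^ 3) ^ 3 * (q ^ n) ^ 3)
                       ≤ B₀ * (p ^ n) ^ 3
  absorb-cubes n = begin
    (suc n ^ d) ^ 3 * 3 ^ n * ((suc n ^ 3) ^ 3 * (q ^ n) ^ 3)
      ≡⟨ interchange ((suc n ^ d) ^ 3) (3 ^ n) ((suc n ^ 3) ^ 3) ((q ^ n) ^ 3) ⟩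
    (suc n ^ d) ^ 3 * (suc n ^ 3) ^ 3 * (3 ^ n * (q ^ n) ^ 3)
      ≡⟨ cong₂ _*_
           (trans (cong₂ _*_ (^-*-assoc (suc n) d 3) (^-*-assoc (suc n) 3 3))
                  (sym (^-distribˡ-+-* (suc n) (d * 3) (3 * 3))))
           (trans (cong (3 ^ n *_) (^-swap q n 3)) (sym (^-distribʳ-* n 3 (q ^ 3)))) ⟩
    suc n ^ (d * 3 + 3 * 3) * (3 * q ^ 3) ^ n
      ≤⟨ proj₂ absorb n ⟩
    B₀ * (p ^ 3) ^ n
      ≡⟨ cong (B₀ *_) (^-swap p 3 n) ⟩
    B₀ * (p ^ n) ^ 3 ∎

  time : ∀ {n m} (𝒢 : GraphSystem n m) →
         cost (algorithmA enum 𝒢) * q ^ n ≤ C * m ^ 1 * p ^ n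
  time {n} {m} 𝒢 = ^-cancelʳ-≤ 3 (begin
    (cost (algorithmA enum 𝒢) * q ^ n) ^ 3
      ≤⟨ ^-monoˡ-≤ 3 (*-monoˡ-≤ (q ^ n) (≤-trans (tryAll-cost 𝒢 run)
           (*-monoʳ-≤ (suc (steps run)) (procedure1Bound-≤ n m (GraphSystem.1≤m 𝒢))))) ⟩
    (suc (steps run) * (3 * m * suc n ^ 3) * q ^ n) ^ 3
      ≡⟨ cube-product (suc (steps run)) m (suc n ^ 3) (q ^ n) ⟩
    suc (steps run) ^ 3 * (27 * m ^ 3 * ((suc n ^ 3) ^ 3 * (q ^ n) ^ 3))
      ≤⟨ *-monoˡ-≤ _ (suc-steps-≤ {c} {d} {steps run} (fast (GraphSystem.G₀ 𝒢))) ⟩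
    A₀ * ((suc n ^ d) ^ 3 * 3 ^ n) * (27 * m ^ 3 * ((suc n ^ 3) ^ 3 * (q ^ n) ^ 3))
      ≡⟨ regroup A₀ ((suc n ^ d) ^ 3 * 3 ^ n) (m ^ 3) ((suc n ^ 3) ^ 3 * (q ^ n) ^ 3) ⟩
    27 * A₀ * m ^ 3 * ((suc n ^ d) ^ 3 * 3 ^ n * ((suc n ^ 3) ^ 3 * (q ^ n) ^ 3))
      ≤⟨ *-monoʳ-≤ (27 * A₀ * m ^ 3) (absorb-cubes n) ⟩
    27 * A₀ * m ^ 3 * (B₀ * (p ^ n) ^ 3)
      ≡⟨ regroup′ (27 * A₀) (m ^ 3) B₀ ((p ^ n) ^ 3) ⟩
    C * (m ^ 3 * (p ^ n) ^ 3)
      -- Replacing C by its cube makes the right side a perfect cube without extracting a root.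
      ≤⟨ *-monoˡ-≤ _ (x≤x^3 C) ⟩
    C ^ 3 * (m ^ 3 * (p ^ n) ^ 3)
      ≡⟨ cube-product′ C m (p ^ n) ⟨
    (C * m ^ 1 * p ^ n) ^ 3 ∎)
    where
    run = enum (GraphSystem.G₀ 𝒢)
    x≤x^3 : ∀ x → x ≤ x ^ 3
    x≤x^3 zero    = z≤n
    x≤x^3 (suc x) = ≤-trans (≤-reflexive (sym (*-identityʳ (suc x))))
      (*-monoʳ-≤ (suc x) (m^n>0 (suc x) 2))
    cube-product : ∀ s m r t →
      s * (3 * m * r) * t * (s * (3 * m * r) * t * (s * (3 * m * r) * t * 1)) ≡
      s * (s * (s * 1)) * (27 * (m * (m * (m * 1))) * (r * (r * (r * 1)) * (t * (t * (t * 1)))))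
    cube-product = solve-∀
    regroup : ∀ a x m y → a * x * (27 * m * y) ≡ 27 * a * m * (x * y)
    regroup = solve-∀
    regroup′ : ∀ a m b t → a * m * (b * t) ≡ a * b * (m * t)
    regroup′ = solve-∀
    cube-product′ : ∀ c m t →
      c * (m * 1) * t * (c * (m * 1) * t * (c * (m * 1) * t * 1)) ≡
      c * (c * (c * 1)) * (m * (m * (m * 1)) * (t * (t * (t * 1))))
    cube-product′ = solve-∀

theorem2p2 : (enum : Enumerator) →
    ListsMaximalIndependentSets enum →
    TimeO[3^n/3·poly] enum →
    DecidesCIS (algorithmA enum) × TimeO[ 14423 / 10000 ^n] (algorithmA enum)
theorem2p2 enum lists fast =
  algorithmA-decides enum lists ,
  -- 1.4423 is the cube root of 3, about 1.44225, rounded up, so the comparison is strict and is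
  -- settled by evaluation.
  algorithmA-time 14423 10000 (from-yes (3 * 10000 ^ 3 <? 14423 ^ 3)) enum fast
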